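{- Let $M(G)$ be the size of a maximum cardinality matching of a graph $G$. For graph sequences of length $T$, the difference sequence of $M$ has continuous global sensitivity at least $T$ when considering edge-adjacent or node-adjacent partially dynamic graph sequences. That is, for each of the two adjacency notions, there are adjacent partially dynamic graph sequences $\mathcal G,\mathcal G'$ of length $T$ with $\sum_{t=1}^T|\Delta M_{\mathcal G}(t)-\Delta M_{\mathcal G'}(t)|\ge T$.
   Context: Graphs are undirected. A graph sequence $\mathcal G=(G_1,\dots,G_T)$, $G_t=(V_t,E_t)$, arises from an initial (possibly non-empty) graph $G_0=(V_0,E_0)$ through updates $(\partial V_t^+,\partial V_t^-,\partial E_t^+,\partial E_t^-)$ by $V_t=(V_{t-1}\setminus\partial V_t^-)\cup\partial V_t^+$, $E_t=(E_{t-1}\setminus\partial E_t^-)\cup\partial E_t^+$; deleting a node deletes all incident edges, and inserted edges have both endpoints in $V_t$. It is incremental if there are no deletions, decremental if there are no insertions, partially dynamic if it is incremental or decremental. Edge-adjacency: same length, same initial graph, same node updates, and (up to exchanging the two sequences) there are an edge $e^*$ and a time $t^*$ such that all edge update sets agree except that at time $t^*$ exactly one of the insertion set or the deletion set of $\mathcal G$ contains additionally the edge $e^*$. Node-adjacency: same length, same initial graph, and (up to exchange) there are a node $v^*$ and a time $t^*$ such that all node update sets agree except that at time $t^*$ exactly one of the node insertion set or node deletion set of $\mathcal G$ contains additionally the node $v^*$; moreover every inserted (deleted) edge is incident to a node inserted (deleted) at the same time, and the edge update sets of $\mathcal G'$ are the maximal subsets of those of $\mathcal G$ containing no edge incident to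 $v^*$. For a graph function $f$ the difference sequence on $\mathcal G$ is $\Delta f_{\mathcal G}(t)=f(G_t)-f(G_{t-1})$; its continuous global sensitivity is the maximum of $\sum_{t=1}^T|\Delta f_{\mathcal G}(t)-\Delta f_{\mathcal G'}(t)|$ over all adjacent $\mathcal G,\mathcal G'$. -}

module Defs where

open import Data.Fin using (Fin; suc; zero; inject₁)
open import Data.Integer as ℤ using (ℤ; +_; ∣_∣)
open import Data.List using (List; []; _∷_; _++_; map; filter; length; tabulate)
open import Data.List.Extrema.Nat using (max)
open import Data.List.Membership.Propositional using (_∈_; _∉_)
open import Data.List.Relation.Unary.AllPairs using (AllPairs; allPairs?)
open import Data.Nat using (ℕ; suc; _≤_; _<_; _≟_)
open import Data.Nat.ListAction using (sum)
open import Data.Product using (Σ-syntax; ∃-syntax; _×_)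
open import Data.Sum using (_⊎_)
open import Relation.Binary.Definitions using (Decidable)
open import Relation.Binary.PropositionalEquality using (_≡_; _≢_)
open import Relation.Nullary using (Dec; ¬_; ¬?; _×-dec_; _⊎-dec_)
open import Relation.Unary using (Pred; _⊆_; _≐_; _∪_; _∖_; ｛_｝)

-- Finite sets are represented by lists, of which only the membership
-- predicate is significant: order and repetitions never matter.

⟦_⟧ : ∀ {A : Set} → List A → Pred A _
⟦ xs ⟧ = _∈ xs

infix 4 _≋_
_≋_ : ∀ {A : Set} → List A → List A → Set
xs ≋ ys = ⟦ xs ⟧ ≐ ⟦ ys ⟧

Node : Set
Node = ℕ

-- An undirected edge is an unordered pair of distinct nodes, listed in
-- increasing order.
record Edge : Set where
  constructor edge
  field
    lo hi  : Node
    .lo<hi : lo < hi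

open Edge public

Incident : Node → Edge → Set
Incident v e = v ≡ lo e ⊎ v ≡ hi e

incident? : Decidable Incident
incident? v e = (v ≟ lo e) ⊎-dec (v ≟ hi e)

record Graph : Set where
  field
    V         : List Node
    E         : List Edge
    endpoints : ∀ {v e} → e ∈ E → Incident v e → v ∈ V

open Graph public

Disjoint : Edge → Edge → Set
Disjoint e f = ¬ Incident (lo e) f × ¬ Incident (hi e) f

disjoint? : Decidable Disjoint
disjoint? e f = ¬? (incident? (lo e) f) ×-dec ¬? (incident? (hi e) f)

-- An edge is not disjoint from itself, so a matching has no repeated entries
-- and its length is its cardinality.
Matching : List Edge → Set
Matching = AllPairs Disjoint

matching? : ∀ es → Dec (Matching es)
matching? = allPairs? disjoint?

sublists : ∀ {A : Set} → List A → List (List A)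
sublists []       = [] ∷ []
sublists (x ∷ xs) = map (x ∷_) (sublists xs) ++ sublists xs

-- The default value 0 of the maximum is the size of the empty matching.
M : Graph → ℕ
M G = max 0 (map length (filter matching? (sublists (E G))))

record Update : Set where
  field
    ∂V⁺ ∂V⁻ : List Node
    ∂E⁺ ∂E⁻ : List Edge

open Update public

record Step (G : Graph) (u : Update) (G′ : Graph) : Set where
  field
    nodes     : ⟦ V G′ ⟧ ≐ (⟦ V G ⟧ ∖ ⟦ ∂V⁻ u ⟧) ∪ ⟦ ∂V⁺ u ⟧
    edges     : ⟦ E G′ ⟧ ≐ (⟦ E G ⟧ ∖ ⟦ ∂E⁻ u ⟧) ∪ ⟦ ∂E⁺ u ⟧
    deletion  : ∀ {v e} → v ∈ ∂V⁻ u → e ∈ E G → Incident v e → e ∈ ∂E⁻ u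
    insertion : ∀ {v e} → e ∈ ∂E⁺ u → Incident v e → v ∈ V G′

-- The times 1, …, T are the elements of Fin T: the element t stands
-- for the step from graph (inject₁ t) to graph (suc t).
record GraphSequence (T : ℕ) : Set where
  field
    graph  : Fin (suc T) → Graph
    update : Fin T → Update
    step   : ∀ t → Step (graph (inject₁ t)) (update t) (graph (suc t))

  initial : Graph
  initial = graph zero

open GraphSequence public

module _ {T : ℕ} where

  Incremental : GraphSequence T → Set
  Incremental 𝒢 = ∀ t → ∂V⁻ (update 𝒢 t) ≡ [] × ∂E⁻ (update 𝒢 t) ≡ []

  Decremental : GraphSequence T → Set
  Decremental 𝒢 = ∀ t → ∂V⁺ (update 𝒢 t) ≡ [] × ∂E⁺ (update 𝒢 t) ≡ []

  PartiallyDynamic : GraphSequence T → Set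
  PartiallyDynamic 𝒢 = Incremental 𝒢 ⊎ Decremental 𝒢

SameGraph : Graph → Graph → Set
SameGraph G G′ = V G ≋ V G′ × E G ≋ E G′

SameNodeUpdate SameEdgeUpdate : Update → Update → Set
SameNodeUpdate u u′ = ∂V⁺ u ≋ ∂V⁺ u′ × ∂V⁻ u ≋ ∂V⁻ u′
SameEdgeUpdate u u′ = ∂E⁺ u ≋ ∂E⁺ u′ × ∂E⁻ u ≋ ∂E⁻ u′

HasExtra : ∀ {A : Set} → A → List A → List A → Set
HasExtra x xs ys = x ∉ ys × ⟦ xs ⟧ ≐ ⟦ ys ⟧ ∪ ｛ x ｝

ExtraEdge : Edge → Update → Update → Set
ExtraEdge e u u′ =
    (HasExtra e (∂E⁺ u) (∂E⁺ u′) × ∂E⁻ u ≋ ∂E⁻ u′)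
  ⊎ (∂E⁺ u ≋ ∂E⁺ u′ × HasExtra e (∂E⁻ u) (∂E⁻ u′))

ExtraNode : Node → Update → Update → Set
ExtraNode v u u′ =
    (HasExtra v (∂V⁺ u) (∂V⁺ u′) × ∂V⁻ u ≋ ∂V⁻ u′)
  ⊎ (∂V⁺ u ≋ ∂V⁺ u′ × HasExtra v (∂V⁻ u) (∂V⁻ u′))

Avoids : Node → List Edge → Set
Avoids v es = ∀ {e} → e ∈ es → ¬ Incident v e

record MaximalAvoiding (v : Node) (es es′ : List Edge) : Set where
  field
    subset  : ⟦ es′ ⟧ ⊆ ⟦ es ⟧
    avoids  : Avoids v es′
    maximal : ∀ fs → ⟦ es′ ⟧ ⊆ ⟦ fs ⟧ → ⟦ fs ⟧ ⊆ ⟦ es ⟧ → Avoids v fs →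
              ⟦ fs ⟧ ⊆ ⟦ es′ ⟧

NodeInduced : Update → Set
NodeInduced u =
    (∀ {e} → e ∈ ∂E⁺ u → ∃[ v ] v ∈ ∂V⁺ u × Incident v e)
  × (∀ {e} → e ∈ ∂E⁻ u → ∃[ v ] v ∈ ∂V⁻ u × Incident v e)

module _ {T : ℕ} where

  -- The first sequence is the one whose update contains the extra edge.
  record EdgeAdjacent₁ (𝒢 𝒢′ : GraphSequence T) : Set where
    field
      same-initial : SameGraph (initial 𝒢) (initial 𝒢′)
      same-nodes   : ∀ t → SameNodeUpdate (update 𝒢 t) (update 𝒢′ t)
      e*           : Edge
      t*           : Fin T
      same-edges   : ∀ t → t ≢ t* → SameEdgeUpdate (update 𝒢 t) (update 𝒢′ t)
      extra-edge   : ExtraEdge e* (update 𝒢 t*) (update 𝒢′ t*)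

  EdgeAdjacent : GraphSequence T → GraphSequence T → Set
  EdgeAdjacent 𝒢 𝒢′ = EdgeAdjacent₁ 𝒢 𝒢′ ⊎ EdgeAdjacent₁ 𝒢′ 𝒢

  -- The first sequence is the one whose update contains the extra node.
  record NodeAdjacent₁ (𝒢 𝒢′ : GraphSequence T) : Set where
    field
      same-initial : SameGraph (initial 𝒢) (initial 𝒢′)
      v*           : Node
      t*           : Fin T
      same-nodes   : ∀ t → t ≢ t* → SameNodeUpdate (update 𝒢 t) (update 𝒢′ t)
      extra-node   : ExtraNode v* (update 𝒢 t*) (update 𝒢′ t*)
      induced      : ∀ t → NodeInduced (update 𝒢 t)
      induced′     : ∀ t → NodeInduced (update 𝒢′ t)
      insertions   : ∀ t → MaximalAvoiding v* (∂E⁺ (update 𝒢 t)) (∂E⁺ (update 𝒢′ t))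
      deletions    : ∀ t → MaximalAvoiding v* (∂E⁻ (update 𝒢 t)) (∂E⁻ (update 𝒢′ t))

  NodeAdjacent : GraphSequence T → GraphSequence T → Set
  NodeAdjacent 𝒢 𝒢′ = NodeAdjacent₁ 𝒢 𝒢′ ⊎ NodeAdjacent₁ 𝒢′ 𝒢

  -- Difference sequence: Δ f 𝒢 t = f (G_t) - f (G_{t-1}).
  Δ : (Graph → ℕ) → GraphSequence T → Fin T → ℤ
  Δ f 𝒢 t = + f (graph 𝒢 (suc t)) ℤ.- + f (graph 𝒢 (inject₁ t))

  -- The ℓ₁-distance of difference sequences, whose maximum over adjacent
  -- sequences is the continuous global sensitivity of Δ f.
  Δ-distance : (Graph → ℕ) → GraphSequence T → GraphSequence T → ℕ
  Δ-distance f 𝒢 𝒢′ = sum (tabulate λ t → ∣ Δ f 𝒢 t ℤ.- Δ f 𝒢′ t ∣)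

  -- The maximum of Δ-distance f over adjacent sequences in the class P is at
  -- least k: some pair of such sequences has distance at least k.
  SensitivityAtLeast : (Graph → ℕ) → (GraphSequence T → Set) →
                       (GraphSequence T → GraphSequence T → Set) → ℕ → Set
  SensitivityAtLeast f P _~_ k =
    Σ[ 𝒢 ∈ GraphSequence T ] Σ[ 𝒢′ ∈ GraphSequence T ]
      P 𝒢 × P 𝒢′ × 𝒢 ~ 𝒢′ × k ≤ Δ-distance f 𝒢 𝒢′

{-# OPTIONS --safe #-}

-- Let 𝒢 build the path 0 – 1 – 2 – ⋯ one edge per step, and let 𝒢′ be the same
-- sequence without the very first edge.  After t steps the path of 𝒢 has t
-- edges and that of 𝒢′ has t ∸ 1, so their maximum matchings have sizes ⌈ t /2⌉
-- and ⌊ t /2⌋: one grows exactly at the odd times and the other exactly at the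
-- even times, so every step contributes 1 to the distance.  The missing edge
-- comes from leaving out either that edge alone or the node 0.  For the latter,
-- node 1 is initially present and node 0 arrives at the first step, so that the
-- rest of the path never touches it.

module Submission where

open import Defs
open import Data.Fin using (Fin; zero; suc; toℕ; inject₁)
open import Data.Fin.Properties using (toℕ-inject₁)
open import Data.Integer as ℤ using (+_; ∣_∣)
open import Data.Integer.Tactic.RingSolver using (solve-∀)
open import Data.List using (List; []; _∷_; _++_; map; length; tabulate; applyDownFrom)
open import Data.List.Extrema.Nat using (max≤v⁺; v≤max⁺)
open import Data.List.Membership.Propositional using (_∈_; lose)
open import Data.List.Membership.Propositional.Properties
  using (∈-map⁺; ∈-map⁻; ∈-++⁺ˡ; ∈-++⁺ʳ; ∈-++⁻; ∈-filter⁺; ∈-filter⁻)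
open import Data.List.Relation.Binary.Sublist.Propositional
  using (_⊆_; []; _∷_; _∷ʳ_)
open import Data.List.Relation.Binary.Sublist.Propositional.Properties
  using (All-resp-⊆)
open import Data.List.Relation.Unary.All as All using ([]; _∷_)
open import Data.List.Relation.Unary.All.Properties using (map⁺; applyDownFrom⁺₁)
open import Data.List.Relation.Unary.AllPairs using ([]; _∷_)
open import Data.List.Relation.Unary.Any using (here; there)
open import Data.Nat using (ℕ; zero; suc; _≤_; _<_; z≤n; s≤s; ⌊_/2⌋; ⌈_/2⌉)
open import Data.Nat.ListAction using (sum)
open import Data.Nat.Properties
  using (≤-refl; ≤-reflexive; ≤-trans; ≤-antisym; +-mono-≤; n≤1+n; n<1+n; m<n⇒m<1+n;
         >⇒≢; ⌈n/2⌉-mono)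
open import Data.Product using (_×_; _,_; proj₁)
open import Data.Sum as Sum using (_⊎_; inj₁; inj₂; [_,_]′)
open import Function using (_∘_; id)
open import Relation.Binary.PropositionalEquality using (_≡_; refl; sym; cong)
open import Relation.Nullary using (¬_; contradiction)

-- Maximum matchings and sublists.

∈-sublists⁺ : ∀ {A : Set} {xs ys : List A} → xs ⊆ ys → xs ∈ sublists ys
∈-sublists⁺               []         = here refl
∈-sublists⁺ {ys = _ ∷ ys} (y ∷ʳ s)   = ∈-++⁺ʳ (map (y ∷_) (sublists ys)) (∈-sublists⁺ s)
∈-sublists⁺               (refl ∷ s) = ∈-++⁺ˡ (∈-map⁺ _ (∈-sublists⁺ s))

∈-sublists⁻ : ∀ {A : Set} {xs : List A} ys → xs ∈ sublists ys → xs ⊆ ys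
∈-sublists⁻ []       (here refl) = []
∈-sublists⁻ (y ∷ ys) xs∈ with ∈-++⁻ (map (y ∷_) (sublists ys)) xs∈
... | inj₂ xs∈′ = y ∷ʳ ∈-sublists⁻ ys xs∈′
... | inj₁ xs∈′ with ∈-map⁻ (y ∷_) xs∈′
...   | _ , zs∈ , refl = refl ∷ ∈-sublists⁻ ys zs∈

-- Together with `M-upper`, this trades the enumeration in `M` for the relation `_⊆_`, on which one
-- can induct.
M-lower : ∀ G {es} → es ⊆ E G → Matching es → length es ≤ M G
M-lower G es⊆E matching = v≤max⁺ 0 _ (inj₂ (lose
  (∈-map⁺ length (∈-filter⁺ matching? (∈-sublists⁺ es⊆E) matching)) ≤-refl))

M-upper : ∀ G {k} → (∀ {es} → es ⊆ E G → Matching es → length es ≤ k) → M G ≤ k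
M-upper G bound = max≤v⁺ z≤n (map⁺ (All.tabulate λ es∈ →
  let es∈sublists , matching = ∈-filter⁻ matching? es∈
  in  bound (∈-sublists⁻ (E G) es∈sublists) matching))

-- Maximum matchings of a path.

module PathMatching
  (e        : ℕ → Edge)
  (adjacent : ∀ i → ¬ Disjoint (e (suc i)) (e i))
  (apart    : ∀ {i j} → suc i < j → Disjoint (e j) (e i))
  where

  -- If the newest edge is chosen, `adjacent` excludes the one before it, and the rest of the
  -- matching lies in the path with two edges fewer. Otherwise the bound for one edge fewer
  -- suffices.
  path-matching-≤ : ∀ n {es} → es ⊆ applyDownFrom e n → Matching es →
                    length es ≤ ⌈ n /2⌉
  path-matching-≤ zero          []          _ = z≤n
  path-matching-≤ (suc zero)    (_ ∷ʳ [])   _ = z≤n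
  path-matching-≤ (suc zero)    (refl ∷ []) _ = ≤-refl
  path-matching-≤ (suc (suc n)) (_ ∷ʳ s)    m =
    ≤-trans (path-matching-≤ (suc n) s m) (⌈n/2⌉-mono (n≤1+n (suc n)))
  path-matching-≤ (suc (suc n)) (refl ∷ (refl ∷ s)) ((d ∷ _) ∷ _) =
    contradiction d (adjacent n)
  path-matching-≤ (suc (suc n)) (refl ∷ (_ ∷ʳ s))   (_ ∷ m) =
    s≤s (path-matching-≤ n s m)

  -- A matching that attains the bound: every second edge, counted from the newest, so that its
  -- length obeys the recursion of `⌈ n /2⌉`.
  alternate : ℕ → List Edge
  alternate zero          = []
  alternate (suc zero)    = e 0 ∷ []
  alternate (suc (suc n)) = e (suc n) ∷ alternate n

  alternate-⊆ : ∀ n → alternate n ⊆ applyDownFrom e n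
  alternate-⊆ zero          = []
  alternate-⊆ (suc zero)    = refl ∷ []
  alternate-⊆ (suc (suc n)) = refl ∷ (_ ∷ʳ alternate-⊆ n)

  alternate-matching : ∀ n → Matching (alternate n)
  alternate-matching zero          = []
  alternate-matching (suc zero)    = [] ∷ []
  alternate-matching (suc (suc n)) =
    -- Every index below `n` is at least two less than `suc n`, so `e (suc n)` is disjoint from the
    -- whole path of `n` edges and hence from the edges chosen there.
    All-resp-⊆ (alternate-⊆ n) (applyDownFrom⁺₁ e n (apart ∘ s≤s))
    ∷ alternate-matching n

  length-alternate : ∀ n → length (alternate n) ≡ ⌈ n /2⌉
  length-alternate zero          = refl
  length-alternate (suc zero)    = refl
  length-alternate (suc (suc n)) = cong suc (length-alternate n)

  M-path : ∀ G n → E G ≡ applyDownFrom e n → M G ≡ ⌈ n /2⌉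
  -- Splitting `G` turns its edge list into a variable, which `refl` can replace by the path.
  M-path G@record { E = _ } n refl = ≤-antisym
    (M-upper G (path-matching-≤ n))
    (≤-trans (≤-reflexive (sym (length-alternate n)))
             (M-lower G (alternate-⊆ n) (alternate-matching n)))

link : ℕ → Edge
link n = edge n (suc n) (n<1+n n)

link-adjacent : ∀ n → ¬ Disjoint (link (suc n)) (link n)
link-adjacent n (lo∉ , _) = lo∉ (inj₂ refl)

link-apart : ∀ {i j} → suc i < j → Disjoint (link j) (link i)
link-apart 1+i<j =
    [ >⇒≢ (≤-trans (n≤1+n _) 1+i<j) , >⇒≢ 1+i<j ]′
  , [ >⇒≢ (m<n⇒m<1+n (≤-trans (n≤1+n _) 1+i<j)) , >⇒≢ (m<n⇒m<1+n 1+i<j) ]′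

-- Incremental sequences from growth data.

accumulate : ∀ {A : Set} → List A → (ℕ → List A) → ℕ → List A
accumulate xs new zero    = xs
accumulate xs new (suc t) = new t ++ accumulate xs new t

-- Indexed by all of `ℕ`, so that the graph after `t` steps does not depend on the length of the
-- sequence. The index `suc t` in `attached` lets an edge arrive together with its endpoints.
record Growth : Set where
  field
    V₀ : List Node
    newV : ℕ → List Node
    newE : ℕ → List Edge
    attached : ∀ t {v e} → e ∈ newE t → Incident v e → v ∈ accumulate V₀ newV (suc t)

module _ (𝒲 : Growth) where
  open Growth 𝒲

  grown : ℕ → Graph
  grown t = record
    { V         = accumulate V₀ newV t
    ; E         = accumulate [] newE t
    ; endpoints = closed t
    }
    where
    closed : ∀ t {v e} → e ∈ accumulate [] newE t → Incident v e →
             v ∈ accumulate V₀ newV t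
    closed (suc t) e∈ v∈e with ∈-++⁻ (newE t) e∈
    ... | inj₁ e∈new = attached t e∈new v∈e
    ... | inj₂ e∈old = ∈-++⁺ʳ (newV t) (closed t e∈old v∈e)

  growth-update : ℕ → Update
  growth-update t = record { ∂V⁺ = newV t ; ∂V⁻ = [] ; ∂E⁺ = newE t ; ∂E⁻ = [] }

  growth-step : ∀ t → Step (grown t) (growth-update t) (grown (suc t))
  growth-step t = record
    { nodes     = insert⁻ (newV t) , insert⁺ (newV t)
    ; edges     = insert⁻ (newE t) , insert⁺ (newE t)
    ; deletion  = λ ()
    ; insertion = attached t
    }
    where
    insert⁻ : ∀ {A : Set} {x : A} xs {ys} → x ∈ xs ++ ys → (x ∈ ys × ¬ x ∈ []) ⊎ x ∈ xs
    insert⁻ xs x∈ with ∈-++⁻ xs x∈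
    ... | inj₁ x∈xs = inj₂ x∈xs
    ... | inj₂ x∈ys = inj₁ (x∈ys , λ ())

    insert⁺ : ∀ {A : Set} {x : A} xs {ys} → (x ∈ ys × ¬ x ∈ []) ⊎ x ∈ xs → x ∈ xs ++ ys
    insert⁺ xs = [ ∈-++⁺ʳ xs ∘ proj₁ , ∈-++⁺ˡ ]′

  growth : ∀ T → GraphSequence T
  growth T = record
    { graph  = grown ∘ toℕ
    ; update = growth-update ∘ toℕ
    ; step   = step′
    }
    where
    step′ : ∀ t → Step (grown (toℕ (inject₁ t))) (growth-update (toℕ t)) (grown (suc (toℕ t)))
    -- `toℕ (inject₁ t)` equals `toℕ t` only propositionally.
    step′ t rewrite toℕ-inject₁ t = growth-step (toℕ t)

  growth-incremental : ∀ T → Incremental (growth T)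
  growth-incremental T t = refl , refl

-- The path sequences.

first-then : ∀ {A : Set} → List A → (ℕ → A) → ℕ → List A
first-then xs f zero    = xs
first-then xs f (suc t) = f t ∷ []

arrivals : List Node → ℕ → List Node
arrivals ws = first-then ws λ t → suc (suc t)

links : List Edge → ℕ → List Edge
links es = first-then es (link ∘ suc)

-- Only the first step varies, bringing `ws` and `es`; each later step brings one new node and the
-- link to it from its predecessor.
path : (ws : List Node) (es : List Edge) →
       (∀ {v e} → e ∈ es → Incident v e → v ∈ ws ++ 1 ∷ []) → Growth
path ws es attached₀ = record
  { V₀       = 1 ∷ []
  ; newV     = arrivals ws
  ; newE     = links es
  ; attached = attached
  }
  where
  newest : ∀ t → suc t ∈ accumulate (1 ∷ []) (arrivals ws) (suc t)
  -- Node 1 belongs to the initial graph, so it stands behind `ws`.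
  newest zero    = ∈-++⁺ʳ ws (here refl)
  newest (suc t) = here refl

  attached : ∀ t {v e} → e ∈ links es t → Incident v e →
             v ∈ accumulate (1 ∷ []) (arrivals ws) (suc t)
  attached zero    e∈          v∈e         = attached₀ e∈ v∈e
  attached (suc t) (here refl) (inj₁ refl) = there (newest t)
  attached (suc t) (here refl) (inj₂ refl) = newest (suc t)

whole-path no-first-edge no-first-node : Growth
whole-path = path (0 ∷ []) (link 0 ∷ []) λ where
  (here refl) (inj₁ refl) → here refl
  (here refl) (inj₂ refl) → there (here refl)
no-first-edge = path (0 ∷ []) [] λ ()
no-first-node = path []       [] λ ()

M-whole-path : ∀ t → M (grown whole-path t) ≡ ⌈ t /2⌉
M-whole-path t = M-path (grown whole-path t) t (edges-whole-path t)
  where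
  open PathMatching link link-adjacent link-apart

  edges-whole-path : ∀ t → accumulate [] (links (link 0 ∷ [])) t ≡ applyDownFrom link t
  edges-whole-path zero          = refl
  edges-whole-path (suc zero)    = refl
  edges-whole-path (suc (suc t)) = cong (link (suc t) ∷_) (edges-whole-path (suc t))

M-shortened-path : ∀ ws t → M (grown (path ws [] λ ()) t) ≡ ⌊ t /2⌋
M-shortened-path ws zero    = refl
-- The first step adds no edge, so `suc t` steps give `t` edges; `⌈ t /2⌉` is `⌊ suc t /2⌋` by
-- definition.
M-shortened-path ws (suc t) = M-path (grown (path ws [] λ ()) (suc t)) t (edges-shortened-path t)
  where
  open PathMatching (link ∘ suc) (link-adjacent ∘ suc) (link-apart ∘ s≤s)

  edges-shortened-path : ∀ t → accumulate [] (links []) (suc t) ≡ applyDownFrom (link ∘ suc) t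
  edges-shortened-path zero    = refl
  edges-shortened-path (suc t) = cong (link (suc t) ∷_) (edges-shortened-path t)

-- The contribution of a single step.

⌈n/2⌉≡⌊n/2⌋⊎1+⌊n/2⌋ : ∀ n → ⌈ n /2⌉ ≡ ⌊ n /2⌋ ⊎ ⌈ n /2⌉ ≡ suc ⌊ n /2⌋
⌈n/2⌉≡⌊n/2⌋⊎1+⌊n/2⌋ zero          = inj₁ refl
⌈n/2⌉≡⌊n/2⌋⊎1+⌊n/2⌋ (suc zero)    = inj₂ refl
⌈n/2⌉≡⌊n/2⌋⊎1+⌊n/2⌋ (suc (suc n)) =
  Sum.map (cong suc) (cong suc) (⌈n/2⌉≡⌊n/2⌋⊎1+⌊n/2⌋ n)

-- Meant for `a` = `⌊ t /2⌋` and `b` = `⌈ t /2⌉`: then `⌈ suc t /2⌉` is `suc a` and `⌊ suc t /2⌋` is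
-- `b`, so the two brackets are the differences of the whole and the shortened path. The signed
-- value is 1 for even `t` and -1 for odd `t`.
∣second-difference∣≡1 : ∀ {a b} → b ≡ a ⊎ b ≡ suc a →
  ∣ (+ suc a ℤ.- + b) ℤ.- (+ b ℤ.- + a) ∣ ≡ 1
∣second-difference∣≡1 {a} (inj₁ refl) = cong ∣_∣ (identity (+ a))
  where
  identity : ∀ x → ((+ 1 ℤ.+ x) ℤ.- x) ℤ.- (x ℤ.- x) ≡ + 1
  identity = solve-∀
∣second-difference∣≡1 {a} (inj₂ refl) = cong ∣_∣ (identity (+ a))
  where
  identity : ∀ x → ((+ 1 ℤ.+ x) ℤ.- (+ 1 ℤ.+ x)) ℤ.- ((+ 1 ℤ.+ x) ℤ.- x) ≡ ℤ.- (+ 1)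
  identity = solve-∀

sum-tabulate-≥ : ∀ {n} {f : Fin n → ℕ} → (∀ i → 1 ≤ f i) → n ≤ sum (tabulate f)
sum-tabulate-≥ {zero}  1≤f = z≤n
sum-tabulate-≥ {suc n} 1≤f = +-mono-≤ (1≤f zero) (sum-tabulate-≥ (1≤f ∘ suc))

Δ-distance-paths : ∀ T ws → T ≤ Δ-distance M (growth whole-path T) (growth (path ws [] λ ()) T)
Δ-distance-paths T ws = sum-tabulate-≥ λ t → ≤-reflexive (sym (one t))
  where
  one : ∀ t → ∣ Δ M (growth whole-path T) t ℤ.- Δ M (growth (path ws [] λ ()) T) t ∣ ≡ 1
  one t rewrite toℕ-inject₁ t
              | M-whole-path (suc (toℕ t)) | M-whole-path (toℕ t)
              | M-shortened-path ws (suc (toℕ t)) | M-shortened-path ws (toℕ t)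
              = ∣second-difference∣≡1 (⌈n/2⌉≡⌊n/2⌋⊎1+⌊n/2⌋ (toℕ t))

-- Adjacency of the path sequences.

≋-refl : ∀ {A : Set} {xs : List A} → xs ≋ xs
≋-refl = id , id

HasExtra-singleton : ∀ {A : Set} (x : A) → HasExtra x (x ∷ []) []
HasExtra-singleton x = (λ ()) , (λ where (here refl) → inj₂ refl) , λ where (inj₂ refl) → here refl

paths-edge-adjacent : ∀ n →
  EdgeAdjacent₁ (growth whole-path (suc n)) (growth no-first-edge (suc n))
paths-edge-adjacent n = record
  { same-initial = ≋-refl , ≋-refl
  ; same-nodes   = λ t → ≋-refl , ≋-refl
  ; e*           = link 0
  ; t*           = zero
  ; same-edges   = λ where
      zero    0≢0 → contradiction refl 0≢0
      (suc t) _   → ≋-refl , ≋-refl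
  ; extra-edge   = inj₁ (HasExtra-singleton (link 0) , ≋-refl)
  }

maximalAvoiding-refl : ∀ {v es} → Avoids v es → MaximalAvoiding v es es
maximalAvoiding-refl avoids = record
  { subset  = id
  ; avoids  = avoids
  ; maximal = λ _ _ fs⊆es _ → fs⊆es
  }

paths-node-adjacent : ∀ n →
  NodeAdjacent₁ (growth whole-path (suc n)) (growth no-first-node (suc n))
paths-node-adjacent n = record
  { same-initial = ≋-refl , ≋-refl
  ; v*           = 0
  ; t*           = zero
  ; same-nodes   = λ where
      zero    0≢0 → contradiction refl 0≢0
      (suc t) _   → ≋-refl , ≋-refl
  ; extra-node   = inj₁ (HasExtra-singleton 0 , ≋-refl)
  ; induced      = λ where
      zero    → (λ where (here refl) → 0 , here refl , inj₁ refl) , λ ()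
      -- The upper end of the new link arrives in the same step.
      (suc t) → (λ where (here refl) → _ , here refl , inj₂ refl) , λ ()
  ; induced′     = λ where
      zero    → (λ ()) , λ ()
      (suc t) → (λ where (here refl) → _ , here refl , inj₂ refl) , λ ()
  ; insertions   = λ where
      -- The only edge inserted here is `link 0`, which is incident to node 0, so the largest subset
      -- avoiding node 0 is empty.
      zero    → record
        { subset  = λ ()
        ; avoids  = λ ()
        ; maximal = λ fs _ fs⊆ avoids f∈ → contradiction (0-incident (fs⊆ f∈)) (avoids f∈)
        }
      -- Later links have both ends positive, so nothing is removed.
      (suc t) → maximalAvoiding-refl λ where
        (here refl) (inj₁ ())
        (here refl) (inj₂ ())
  ; deletions    = λ t → maximalAvoiding-refl λ ()
  }
  where
  0-incident : ∀ {f} → f ∈ link 0 ∷ [] → Incident 0 f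
  0-incident (here refl) = inj₁ refl

lemma21 : (T : ℕ) → 1 ≤ T →
    SensitivityAtLeast {T} M PartiallyDynamic EdgeAdjacent T
    × SensitivityAtLeast {T} M PartiallyDynamic NodeAdjacent T
-- Positive length provides the first step, which serves as `t*`.
lemma21 T@(suc n) _ =
    ( growth whole-path T , growth no-first-edge T
    , inj₁ (growth-incremental whole-path T) , inj₁ (growth-incremental no-first-edge T)
    , inj₁ (paths-edge-adjacent n) , Δ-distance-paths T (0 ∷ []) )
  , ( growth whole-path T , growth no-first-node T
    , inj₁ (growth-incremental whole-path T) , inj₁ (growth-incremental no-first-node T)
    , inj₁ (paths-node-adjacent n) , Δ-distance-paths T [] )
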